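{- Fix an integer $k\ge 2$. For each $n\in\mathbb{N}$, let $H_{k,n}$ be the number of subsets of $\{1,2,\ldots,n\}$ that (1) satisfy the $k$-Zeckendorf condition, (2) contain $n$, and (3) are weak-Schreier. Then $$H_{k,n}=\begin{cases}1, & \text{if } 1\le n\le k+1;\\ H_{k,n-1}+H_{k,n-(k+1)}, & \text{if } n>k+1.\end{cases}$$
   Context: $\mathbb{N}=\{1,2,3,\ldots\}$. A nonempty finite set $S\subseteq\mathbb{N}$ is weak-Schreier if $\min S\ge |S|$. A finite set of natural numbers satisfies the $k$-Zeckendorf condition if any two distinct numbers in the set are at least $k$ apart (singletons satisfy this vacuously). -}

module Defs where

open import Data.Bool.Base using (Bool; true; false)
open import Data.Fin.Base using (Fin; toℕ) renaming (_≤_ to _≤ᶠ_)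
import Data.Fin.Properties as Fin
open import Data.Fin.Subset using (Subset; inside; outside; _∈_; ∣_∣; Lift)
open import Data.Fin.Subset.Properties using (_∈?_; Lift?)
open import Data.List.Base using (List; []; _∷_; length; filter; cartesianProductWith)
import Data.List.Membership.Propositional as List
open import Data.List.Membership.Propositional.Properties
  using (∈-cartesianProductWith⁺)
open import Data.List.Relation.Unary.All using ([]; _∷_)
open import Data.List.Relation.Unary.Any using (here; there)
open import Data.List.Relation.Unary.Unique.Propositional using (Unique; []; _∷_)
open import Data.List.Relation.Unary.Unique.Propositional.Properties
  using (cartesianProductWith⁺)
open import Data.Nat.Base using (ℕ; zero; suc; _≤_; ∣_-_∣)
open import Data.Nat.Properties using (_≟_; _≤?_)
open import Data.Product.Base using (∃; _×_)
import Data.Vec.Base as Vec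
import Data.Vec.Properties as Vec
open import Relation.Binary.PropositionalEquality using (_≡_; _≢_; refl)
open import Relation.Nullary using (¬?; _×-dec_; _→-dec_)
open import Relation.Unary using (Decidable)

private
  variable
    n : ℕ

-- A subset of {1, …, n} is a  Subset n , in which the position  i : Fin n
-- (counted from 0) stands for the number  toℕ i + 1.

label : Fin n → ℕ
label i = suc (toℕ i)

Contains : ℕ → Subset n → Set
Contains m S = ∃ λ i → label i ≡ m × i ∈ S

Zeckendorf : ℕ → Subset n → Set
Zeckendorf k S =
  Lift (λ i → Lift (λ j → i ≢ j → k ≤ ∣ label i - label j ∣) S) S

IsMin : Subset n → Fin n → Set
IsMin S i = i ∈ S × Lift (i ≤ᶠ_) S

-- Nonemptiness of S is implied by the existence of a minimum.
WeakSchreier : Subset n → Set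
WeakSchreier S = ∃ λ i → IsMin S i × ∣ S ∣ ≤ label i

Admissible : ℕ → (n : ℕ) → Subset n → Set
Admissible k n S = Zeckendorf k S × Contains n S × WeakSchreier S

contains? : ∀ m → Decidable (Contains {n} m)
contains? m S = Fin.any? λ i → (label i ≟ m) ×-dec (i ∈? S)

zeckendorf? : ∀ k → Decidable (Zeckendorf {n} k)
zeckendorf? k S =
  Lift? (λ i → Lift? (λ j → ¬? (i Fin.≟ j) →-dec (k ≤? ∣ label i - label j ∣)) S) S

isMin? : (S : Subset n) → Decidable (IsMin S)
isMin? S i = (i ∈? S) ×-dec Lift? (i Fin.≤?_) S

weakSchreier? : Decidable (WeakSchreier {n})
weakSchreier? S = Fin.any? λ i → isMin? S i ×-dec (∣ S ∣ ≤? label i)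

admissible? : ∀ k n → Decidable (Admissible k n)
admissible? k n S = zeckendorf? k S ×-dec (contains? n S ×-dec weakSchreier? S)

subsets : ∀ n → List (Subset n)
subsets zero    = Vec.[] ∷ []
subsets (suc n) = cartesianProductWith Vec._∷_ (outside ∷ inside ∷ []) (subsets n)

-- Every subset occurs in the list exactly once, so that lengths of filtered
-- sublists are cardinalities.

subsets-complete : (S : Subset n) → S List.∈ subsets n
subsets-complete Vec.[]      = here refl
subsets-complete (b Vec.∷ S) =
  ∈-cartesianProductWith⁺ Vec._∷_ (side b) (subsets-complete S)
  where
  side : (b : Bool) → b List.∈ (outside ∷ inside ∷ [])
  side false = here refl
  side true  = there (here refl)

subsets-unique : ∀ n → Unique (subsets n)
subsets-unique zero    = [] ∷ []
subsets-unique (suc n) =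
  cartesianProductWith⁺ Vec._∷_ Vec.∷-injective (((λ ()) ∷ []) ∷ [] ∷ []) (subsets-unique n)

-- Only the values at n ≥ 1 are meaningful.
H : ℕ → ℕ → ℕ
H k n = length (filter (admissible? k n) (subsets n))

{-# OPTIONS --safe #-}
module Submission where

-- For R : ℕ → ℕ → Set let  count R n  be the number of k-Zeckendorf subsets S of
-- {1, …, n} that contain n and satisfy R ∣S∣ i for every position i of S.  Removing
-- the first position gives, for n ≥ 1, a recursion expressing count R (n + 1) as a
-- sum of two values of count at n, with other relations.  Write a j n for the count
-- with ∣S∣ ≤ j + min S, and p j n for the count with ∣S∣ ≤ j.  The recursion shows
-- that  a j (n+1) - a (j+1) n = p (j+1) (n+1) - p (j+1) n,  both sides counting the
-- sets that contain 1, and then induction on m yields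
--   a (j+1) (k+m) + p j m = a j (k+m) + a j m,
-- whose case j = 0 is the theorem, because H k n = a 0 n and a 0 (n+1) = a 1 n for
-- n ≥ 1.

open import Defs
open import Data.Bool.Base using (true; false)
open import Data.Fin.Base using (Fin; zero; suc; toℕ)
open import Data.Fin.Subset using (Subset; inside; outside; _∈_; ∣_∣; Lift)
open import Data.Fin.Subset.Properties using (Lift?; x∈p⇒∣p-x∣<∣p∣)
open import Data.List.Base using (List; []; _∷_; _++_; length; filter; map)
open import Data.List.Properties
  using (length-++; ++-identityʳ; filter-++; filter-≐; filter-none; filter-all)
open import Data.List.Relation.Unary.All as All using ([]; _∷_)
open import Data.Nat.Base
  using (ℕ; zero; suc; _+_; _∸_; _≤_; _<_; z≤n; s≤s; s≤s⁻¹)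
open import Data.Nat.Properties
open import Data.Nat.Tactic.RingSolver using (solve-∀)
open import Data.Product.Base using (∃; _×_; _,_; proj₁; proj₂; map₂)
open import Data.Vec.Base using ([]; _∷_; here; there)
open import Function.Base using (_∘_)
open import Relation.Binary.Definitions using () renaming (Decidable to Decidable₂)
open import Relation.Binary.PropositionalEquality
  using (_≡_; refl; sym; trans; cong; cong₂; subst; module ≡-Reasoning)
open import Relation.Nullary using (¬_; does; contradiction; _×-dec_)
open import Relation.Unary using (Decidable; _≐_)

private
  variable
    m n : ℕ

-- Counting subsets by whether they contain the first position

length-filter-map : ∀ {A B : Set} {P : B → Set} (P? : Decidable P) (f : A → B) xs →
  length (filter P? (map f xs)) ≡ length (filter (P? ∘ f) xs)
length-filter-map P? f []       = refl
length-filter-map P? f (x ∷ xs) with does (P? (f x))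
... | true  = cong suc (length-filter-map P? f xs)
... | false = length-filter-map P? f xs

card : {P : Subset n → Set} → Decidable P → ℕ
card {n} P? = length (filter P? (subsets n))

module _ {P : Subset n → Set} (P? : Decidable P) where

  card-≐ : {Q : Subset n → Set} (Q? : Decidable Q) → P ≐ Q → card P? ≡ card Q?
  card-≐ Q? P≐Q = cong length (filter-≐ P? Q? P≐Q (subsets n))

  card-none : (∀ S → ¬ P S) → card P? ≡ 0
  card-none ¬P = cong length (filter-none P? (All.universal ¬P (subsets n)))

card-∷ : {P : Subset (suc n) → Set} (P? : Decidable P) →
  card P? ≡ card (P? ∘ (outside ∷_)) + card (P? ∘ (inside ∷_))
card-∷ {n} P? = begin
  length (filter P? (out ++ (ins ++ [])))
    ≡⟨ cong (λ xs → length (filter P? (out ++ xs))) (++-identityʳ ins) ⟩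
  length (filter P? (out ++ ins))
    ≡⟨ cong length (filter-++ P? out ins) ⟩
  length (filter P? out ++ filter P? ins)
    ≡⟨ length-++ (filter P? out) ⟩
  length (filter P? out) + length (filter P? ins)
    ≡⟨ cong₂ _+_ (length-filter-map P? _ (subsets n)) (length-filter-map P? _ (subsets n)) ⟩
  card (P? ∘ (outside ∷_)) + card (P? ∘ (inside ∷_)) ∎
  where
  open ≡-Reasoning
  out ins : List (Subset (suc n))
  out = map (outside ∷_) (subsets n)
  ins = map (inside ∷_) (subsets n)

-- The defining conditions under removal of the first position

contains-∷⁺ : ∀ {b} {S : Subset n} → Contains m S → Contains (suc m) (b ∷ S)
contains-∷⁺ (i , refl , i∈S) = suc i , refl , there i∈S

contains-∷⁻ : ∀ {b} {S : Subset n} → Contains (suc (suc m)) (b ∷ S) → Contains (suc m) S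
contains-∷⁻ (suc i , refl , there i∈S) = i , refl , i∈S

¬contains-0 : {S : Subset n} → ¬ Contains 0 S
¬contains-0 (_ , () , _)

module _ {k : ℕ} {S : Subset n} where

  zeckendorf-tail : ∀ {b} → Zeckendorf k (b ∷ S) → Zeckendorf k S
  zeckendorf-tail z i∈S j∈S i≢j = z (there i∈S) (there j∈S) λ { refl → i≢j refl }

  zeckendorf-outside : Zeckendorf k S → Zeckendorf k (outside ∷ S)
  zeckendorf-outside z (there i∈S) (there j∈S) i≢j = z i∈S j∈S λ { refl → i≢j refl }

  zeckendorf-gap : Zeckendorf k (inside ∷ S) → Lift (λ i → k ≤ label i) S
  zeckendorf-gap z i∈S = z here (there i∈S) λ ()

  zeckendorf-inside : Zeckendorf k S → Lift (λ i → k ≤ label i) S →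
    Zeckendorf k (inside ∷ S)
  zeckendorf-inside z gap here        here        i≢j = contradiction refl i≢j
  zeckendorf-inside z gap here        (there j∈S) i≢j = gap j∈S
  zeckendorf-inside z gap (there i∈S) here        i≢j = gap i∈S
  zeckendorf-inside z gap (there i∈S) (there j∈S) i≢j =
    z i∈S j∈S λ { refl → i≢j refl }

minimum : {S : Subset n} {i : Fin n} → i ∈ S → ∃ (IsMin S)
minimum {S = inside  ∷ S} _           = zero , here , λ _ → z≤n
minimum {S = outside ∷ S} (there i∈S) with minimum i∈S
... | l , l∈S , min = suc l , there l∈S , λ { (there x∈S) → s≤s (min x∈S) }

∈⇒0<∣∣ : {S : Subset n} {i : Fin n} → i ∈ S → 0 < ∣ S ∣
∈⇒0<∣∣ i∈S = ≤-<-trans z≤n (x∈p⇒∣p-x∣<∣p∣ i∈S)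

-- Relations between size and position, and the recursion for their counts

AtMost : ℕ → ℕ → ℕ → Set
AtMost j s i = s ≤ j + suc i

atMost? : ∀ j → Decidable₂ (AtMost j)
atMost? j s i = s ≤? j + suc i

Gap : ℕ → ℕ → ℕ → ℕ → Set
Gap g j s i = g ≤ i × s ≤ j

gap? : ∀ g j → Decidable₂ (Gap g j)
gap? g j s i = (g ≤? i) ×-dec (s ≤? j)

-- The distance k of the text is  suc k  from here on, so that a set containing the
-- position 0 has no other position i < suc k, that is, no position suc i with i < k.
module _ (k : ℕ) where

  -- Imposing `R` on every element instead of on the minimum lets it pass to the tail element by
  -- element. For `AtMost j` this is equivalent to `∣ S ∣ ≤ j + min S`, as the bound is strictest at
  -- the minimum.
  Restricted : (ℕ → ℕ → Set) → Subset n → Set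
  Restricted {n} R S =
    Zeckendorf (suc k) S × Contains n S × Lift (λ i → R ∣ S ∣ (toℕ i)) S

  restricted? : ∀ n {R : ℕ → ℕ → Set} → Decidable₂ R → Decidable (Restricted {n} R)
  restricted? n R? S =
    zeckendorf? (suc k) S ×-dec (contains? n S ×-dec Lift? (λ i → R? ∣ S ∣ (toℕ i)) S)

  count : {R : ℕ → ℕ → Set} → Decidable₂ R → ℕ → ℕ
  count R? n = card (restricted? n R?)

  Tail : (ℕ → ℕ → Set) → ℕ → ℕ → Set
  Tail R s i = R s (suc i)

  tail? : {R : ℕ → ℕ → Set} → Decidable₂ R → Decidable₂ (Tail R)
  tail? R? s i = R? s (suc i)

  -- The condition left on the tail when position 0 is removed from a set containing it. The
  -- requirement `R (suc s) 0` concerns the removed position but is attached to each element of the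
  -- tail.
  Headed : (ℕ → ℕ → Set) → ℕ → ℕ → Set
  Headed R s i = k ≤ i × R (suc s) 0 × R (suc s) (suc i)

  headed? : {R : ℕ → ℕ → Set} → Decidable₂ R → Decidable₂ (Headed R)
  headed? R? s i = (k ≤? i) ×-dec (R? (suc s) 0 ×-dec R? (suc s) (suc i))

  module _ {R : ℕ → ℕ → Set} (R? : Decidable₂ R) where

    count-cong : {Q : ℕ → ℕ → Set} (Q? : Decidable₂ Q) →
      (∀ {s i} → R s i → Q s i) → (∀ {s i} → Q s i → R s i) →
      ∀ n → count R? n ≡ count Q? n
    count-cong Q? R⇒Q Q⇒R n = card-≐ (restricted? n R?) (restricted? n Q?)
      ( (λ (z , c , r) → z , c , λ x∈S → R⇒Q (r x∈S))
      , (λ (z , c , q) → z , c , λ x∈S → Q⇒R (q x∈S)) )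

    count-0 : count R? 0 ≡ 0
    count-0 = card-none (restricted? 0 R?) λ { S (_ , c , _) → ¬contains-0 c }

    -- Every counted set has the last position `n` as an element and so has positive size.
    count-none : ∀ n → (∀ s → ¬ R (suc s) n) → count R? (suc n) ≡ 0
    count-none n ¬R = card-none (restricted? (suc n) R?) none
      where
      none : (S : Subset (suc n)) → ¬ Restricted R S
      none S (_ , (i , label≡ , i∈S) , r)
        with ∣ S ∣ | ∈⇒0<∣∣ i∈S | subst (R ∣ S ∣) (suc-injective label≡) (r i∈S)
      ... | suc s | _ | rs = ¬R s rs

    count-1 : R 1 0 → count R? 1 ≡ 1
    count-1 r = begin
      count R? 1
        ≡⟨ card-∷ (restricted? 1 R?) ⟩
      card (restricted? 1 R? ∘ (outside ∷_)) + card (restricted? 1 R? ∘ (inside ∷_))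
        ≡⟨ cong₂ _+_
             (card-none (restricted? 1 R? ∘ (outside ∷_))
               λ { [] (_ , (zero , _ , ()) , _) })
             (cong length (filter-all (restricted? 1 R? ∘ (inside ∷_)) (full ∷ []))) ⟩
      1 ∎
      where
      open ≡-Reasoning
      full : Restricted R (inside ∷ [])
      full = zeckendorf-inside (λ ()) (λ ()) , (zero , refl , here) , λ { here → r }

    -- In {1, ..., n + 2} the required last number is not the first position, so it survives in the
    -- tail.
    count-suc : ∀ n → count R? (suc (suc n)) ≡
      count (tail? R?) (suc n) + count (headed? R?) (suc n)
    count-suc n = begin
      count R? (suc (suc n))
        ≡⟨ card-∷ (restricted? (suc (suc n)) R?) ⟩
      card (restricted? (suc (suc n)) R? ∘ (outside ∷_)) + card (restricted? (suc (suc n)) R? ∘ (inside ∷_))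
        ≡⟨ cong₂ _+_
             (card-≐ (restricted? (suc (suc n)) R? ∘ (outside ∷_)) (restricted? (suc n) (tail? R?)) (out⇒ , out⇐))
             (card-≐ (restricted? (suc (suc n)) R? ∘ (inside ∷_)) (restricted? (suc n) (headed? R?)) (in⇒ , in⇐)) ⟩
      count (tail? R?) (suc n) + count (headed? R?) (suc n) ∎
      where
      open ≡-Reasoning
      out⇒ : {S : Subset (suc n)} → Restricted R (outside ∷ S) → Restricted (Tail R) S
      out⇒ (z , c , r) = zeckendorf-tail z , contains-∷⁻ c , λ x∈S → r (there x∈S)
      out⇐ : {S : Subset (suc n)} → Restricted (Tail R) S → Restricted R (outside ∷ S)
      out⇐ (z , c , r) = zeckendorf-outside z , contains-∷⁺ c , λ { (there x∈S) → r x∈S }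
      in⇒ : {S : Subset (suc n)} → Restricted R (inside ∷ S) → Restricted (Headed R) S
      in⇒ (z , c , r) = zeckendorf-tail z , contains-∷⁻ c ,
        λ x∈S → s≤s⁻¹ (zeckendorf-gap z x∈S) , r here , r (there x∈S)
      in⇐ : {S : Subset (suc n)} → Restricted (Headed R) S → Restricted R (inside ∷ S)
      -- The last number lies in the tail, and the condition on position 0 is read off from it.
      in⇐ (z , c@(_ , _ , l∈S) , r) =
        zeckendorf-inside z (λ x∈S → s≤s (proj₁ (r x∈S))) , contains-∷⁺ c ,
        λ { here → proj₁ (proj₂ (r l∈S)) ; (there x∈S) → proj₂ (proj₂ (r x∈S)) }

  -- Recursions for the two families of counts

  a : ℕ → ℕ → ℕ
  a j = count (atMost? j)

  gap : ℕ → ℕ → ℕ → ℕ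
  gap g j = count (gap? g j)

  p : ℕ → ℕ → ℕ
  p = gap 0

  -- Without 1, removing the first position lowers the minimum by one, so `j` grows by one. With 1,
  -- the minimum is 1 and the bound says that the tail has at most `j` elements.
  a-suc : ∀ j n → a j (suc (suc n)) ≡ a (suc j) (suc n) + gap k j (suc n)
  a-suc j n = trans (count-suc (atMost? j) n) (cong₂ _+_
    (count-cong (tail? (atMost? j)) (atMost? (suc j))
      (λ {s} {i} → subst (s ≤_) (+-suc j (suc i)))
      (λ {s} {i} → subst (s ≤_) (sym (+-suc j (suc i)))) (suc n))
    (count-cong (headed? (atMost? j)) (gap? k j)
      (λ {s} (k≤i , s<j+1 , _) → k≤i , s≤s⁻¹ (subst (suc s ≤_) (+-comm j 1) s<j+1))
      (λ {s} {i} (k≤i , s≤j) → k≤i , subst (suc s ≤_) (+-comm 1 j) (s≤s s≤j) ,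
        ≤-trans (s≤s s≤j) (subst (suc j ≤_) (sym (+-suc j (suc i))) (s≤s (m≤m+n j (suc i)))))
      (suc n)))

  -- The index `suc j` makes the sets containing 1 contribute the same term `gap k j` as in `a-suc`.
  p-suc : ∀ j n → p (suc j) (suc (suc n)) ≡ p (suc j) (suc n) + gap k j (suc n)
  p-suc j n = trans (count-suc (gap? 0 (suc j)) n) (cong₂ _+_
    (count-cong (tail? (gap? 0 (suc j))) (gap? 0 (suc j))
      (λ (_ , s≤) → z≤n , s≤) (λ (_ , s≤) → z≤n , s≤) (suc n))
    (count-cong (headed? (gap? 0 (suc j))) (gap? k j)
      (λ (k≤i , (_ , s<) , _) → k≤i , s≤s⁻¹ s<)
      (λ (k≤i , s≤j) → k≤i , (z≤n , s≤s s≤j) , (z≤n , s≤s s≤j)) (suc n)))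

  gap-none : ∀ {g n} j → n < g → gap g j (suc n) ≡ 0
  gap-none {g} {n} j n<g = count-none (gap? g j) n λ _ (g≤n , _) → <⇒≱ n<g g≤n

  -- A positive gap excludes position 0, so only the tail term of `count-suc` remains, with the gap
  -- shortened by one. For `n = 0` both counts vanish.
  gap-suc : ∀ g j n → gap (suc g) j (suc n) ≡ gap g j n
  gap-suc g j zero    = trans (gap-none j (s≤s (z≤n {g}))) (sym (count-0 (gap? g j)))
  gap-suc g j (suc n) = begin
    gap (suc g) j (suc (suc n))
      ≡⟨ count-suc (gap? (suc g) j) n ⟩
    count (tail? (gap? (suc g) j)) (suc n) + count (headed? (gap? (suc g) j)) (suc n)
      ≡⟨ cong₂ _+_
           (count-cong (tail? (gap? (suc g) j)) (gap? g j)
             (λ (g≤i , s≤j) → s≤s⁻¹ g≤i , s≤j) (λ (g≤i , s≤j) → s≤s g≤i , s≤j) (suc n))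
           (count-none (headed? (gap? (suc g) j)) n λ { _ (_ , (() , _) , _) }) ⟩
    gap g j (suc n) + 0
      ≡⟨ +-identityʳ _ ⟩
    gap g j (suc n) ∎
    where open ≡-Reasoning

  gap-+ : ∀ g j n → gap g j (g + n) ≡ p j n
  gap-+ zero    j n = refl
  gap-+ (suc g) j n = trans (gap-suc g j (g + n)) (gap-+ g j n)

  gap-size-0 : ∀ g n → gap g 0 n ≡ 0
  gap-size-0 g zero    = count-0 (gap? g 0)
  gap-size-0 g (suc n) = count-none (gap? g 0) n λ { _ (_ , ()) }

  a-1 : ∀ j → a j 1 ≡ 1
  a-1 j = count-1 (atMost? j) (m≤n+m 1 j)

  -- Only the singleton of the last number is counted: a second element would be too close to it.
  a-small : ∀ j → n ≤ k → a j (suc n) ≡ 1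
  a-small {zero}  j _   = a-1 j
  a-small {suc n} j n<k = trans (a-suc j n)
    (cong₂ _+_ (a-small (suc j) (<⇒≤ n<k)) (gap-none j n<k))

  a-p-suc : ∀ j n → a j (suc n) + p (suc j) n ≡ p (suc j) (suc n) + a (suc j) n
  -- `count-suc` starts at 2, so the counts at 1 and 0 are compared directly.
  a-p-suc j zero = cong₂ _+_
    (trans (a-1 j) (sym (count-1 (gap? 0 (suc j)) (z≤n , s≤s z≤n))))
    (trans (count-0 (gap? 0 (suc j))) (sym (count-0 (atMost? (suc j)))))
  a-p-suc j (suc n) = begin
    a j (2 + n) + p (suc j) (suc n)
      ≡⟨ cong (_+ p (suc j) (suc n)) (a-suc j n) ⟩
    (a (suc j) (suc n) + gap k j (suc n)) + p (suc j) (suc n)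
      ≡⟨ swap (a (suc j) (suc n)) (gap k j (suc n)) (p (suc j) (suc n)) ⟩
    (p (suc j) (suc n) + gap k j (suc n)) + a (suc j) (suc n)
      ≡⟨ cong (_+ a (suc j) (suc n)) (p-suc j n) ⟨
    p (suc j) (2 + n) + a (suc j) (suc n) ∎
    where
    open ≡-Reasoning
    swap : ∀ x y z → (x + y) + z ≡ (z + y) + x
    swap = solve-∀

  a-step : ∀ j m → a j (suc (k + suc m)) ≡ a (suc j) (suc (k + m)) + p j (suc m)
  a-step j m = begin
    a j (suc (k + suc m))
      ≡⟨ cong (a j ∘ suc) (+-suc k m) ⟩
    a j (suc (suc (k + m)))
      ≡⟨ a-suc j (k + m) ⟩
    a (suc j) (suc (k + m)) + gap k j (suc (k + m))
      ≡⟨ cong (λ x → a (suc j) (suc (k + m)) + gap k j x) (+-suc k m) ⟨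
    a (suc j) (suc (k + m)) + gap k j (k + suc m)
      ≡⟨ cong (a (suc j) (suc (k + m)) +_) (gap-+ k j (suc m)) ⟩
    a (suc j) (suc (k + m)) + p j (suc m) ∎
    where open ≡-Reasoning

  -- The induction on `m` needs all `j` at once, since `a-step` raises `j` and the hypothesis is
  -- used at `suc j`.
  a-p-+ : ∀ j m → a (suc j) (suc k + m) + p j m ≡ a j (suc k + m) + a j m
  a-p-+ j zero = cong₂ _+_
    (trans (a-small (suc j) k+0≤k) (sym (a-small j k+0≤k)))
    (trans (count-0 (gap? 0 j)) (sym (count-0 (atMost? j))))
    where
    k+0≤k : k + 0 ≤ k
    k+0≤k = ≤-reflexive (+-identityʳ k)
  -- The term  p (suc j) m , needed for both a-p-suc and the induction hypothesis, is
  -- added to the two sides and cancelled at the end.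
  a-p-+ j (suc m) = +-cancelʳ-≡ (p (suc j) m) _ _ (begin
    (a (suc j) (suc k + suc m) + p j (suc m)) + p (suc j) m
      ≡⟨ cong (λ x → (x + p j (suc m)) + p (suc j) m) (a-step (suc j) m) ⟩
    ((a (2 + j) (suc k + m) + p (suc j) (suc m)) + p j (suc m)) + p (suc j) m
      ≡⟨ regroup₁ (a (2 + j) (suc k + m)) _ _ _ ⟩
    (a (2 + j) (suc k + m) + p (suc j) m) + (p (suc j) (suc m) + p j (suc m))
      ≡⟨ cong (_+ (p (suc j) (suc m) + p j (suc m))) (a-p-+ (suc j) m) ⟩
    (a (suc j) (suc k + m) + a (suc j) m) + (p (suc j) (suc m) + p j (suc m))
      ≡⟨ regroup₂ (a (suc j) (suc k + m)) _ _ _ ⟩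
    (a (suc j) (suc k + m) + p j (suc m)) + (p (suc j) (suc m) + a (suc j) m)
      ≡⟨ cong₂ _+_ (a-step j m) (a-p-suc j m) ⟨
    a j (suc k + suc m) + (a j (suc m) + p (suc j) m)
      ≡⟨ +-assoc (a j (suc k + suc m)) _ _ ⟨
    (a j (suc k + suc m) + a j (suc m)) + p (suc j) m ∎)
    where
    open ≡-Reasoning
    regroup₁ : ∀ w x y z → ((w + x) + y) + z ≡ (w + z) + (x + y)
    regroup₁ = solve-∀
    regroup₂ : ∀ w x y z → (w + x) + (y + z) ≡ (w + z) + (y + x)
    regroup₂ = solve-∀

  -- Return to `H`

  H≡a : ∀ n → H (suc k) n ≡ a 0 n
  H≡a n = card-≐ (admissible? (suc k) n) (restricted? n (atMost? 0))
    ( (λ (z , c , _ , (_ , min) , s≤) → z , c , λ x∈S → ≤-trans s≤ (s≤s (min x∈S)))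
    , λ (z , c@(_ , _ , l∈S) , r) → z , c ,
        map₂ (λ isMin → isMin , r (proj₁ isMin)) (minimum l∈S) )

  -- A set containing 1 with size at most its minimum would be a singleton, yet it also contains
  -- `n + 2`.
  a-0-suc : ∀ n → a 0 (suc (suc n)) ≡ a 1 (suc n)
  a-0-suc n = begin
    a 0 (suc (suc n))
      ≡⟨ a-suc 0 n ⟩
    a 1 (suc n) + gap k 0 (suc n)
      ≡⟨ cong (a 1 (suc n) +_) (gap-size-0 k (suc n)) ⟩
    a 1 (suc n) + 0
      ≡⟨ +-identityʳ _ ⟩
    a 1 (suc n) ∎
    where open ≡-Reasoning

  -- `a-0-suc` extends the range of `a-small` by one, which accounts for the bound `k + 1` of the
  -- theorem.
  H-small : n ≤ suc k → H (suc k) (suc n) ≡ 1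
  H-small {zero}  _   = trans (H≡a 1) (a-1 0)
  H-small {suc n} n<k = trans (H≡a (suc (suc n))) (trans (a-0-suc n) (a-small 1 (s≤s⁻¹ n<k)))

  H-+ : ∀ m → H (suc k) (suc (suc k + m)) ≡ H (suc k) (suc k + m) + H (suc k) m
  H-+ m = begin
    H (suc k) (suc (suc k + m))
      ≡⟨ H≡a (suc (suc k + m)) ⟩
    a 0 (suc (suc k + m))
      ≡⟨ a-0-suc (k + m) ⟩
    a 1 (suc k + m)
      ≡⟨ +-identityʳ _ ⟨
    a 1 (suc k + m) + 0
      ≡⟨ cong (a 1 (suc k + m) +_) (gap-size-0 0 m) ⟨
    a 1 (suc k + m) + p 0 m
      ≡⟨ a-p-+ 0 m ⟩
    a 0 (suc k + m) + a 0 m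
      ≡⟨ cong₂ _+_ (H≡a (suc k + m)) (H≡a m) ⟨
    H (suc k) (suc k + m) + H (suc k) m ∎
    where open ≡-Reasoning

theorem4 : (k : ℕ) → 2 ≤ k → (n : ℕ) → 1 ≤ n →
    (n ≤ k + 1 → H k n ≡ 1) ×
    (k + 1 < n → H k n ≡ H k (n ∸ 1) + H k (n ∸ (k + 1)))
theorem4 (suc k) _ (suc n) _ = small , large
  where
  small : suc n ≤ suc k + 1 → H (suc k) (suc n) ≡ 1
  small n<k+2 = H-small k (s≤s⁻¹ (subst (suc n ≤_) (+-comm (suc k) 1) n<k+2))
  large : suc k + 1 < suc n →
    H (suc k) (suc n) ≡ H (suc k) n + H (suc k) (suc n ∸ (suc k + 1))
  -- `H-+` is applied with `m = n ∸ suc k`; the hypothesis gives `suc k ≤ n`, so that `suc k + m` is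
  -- `n`.
  large k+2<n+1 rewrite +-comm k 1 =
    subst (λ x → H (suc k) (suc x) ≡ H (suc k) x + H (suc k) (n ∸ suc k))
      (m+[n∸m]≡n (<⇒≤ (s≤s⁻¹ k+2<n+1))) (H-+ k (n ∸ suc k))
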